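{- Let $t$ be a positive integer and let $G$ be a graph on $4t-1$ vertices with $\alpha(G)=2$ and $\mathrm{cm}(G)\le t-1$. Let $S_0,S_1,S_2$ be pairwise disjoint subsets of $V(G)$ (some possibly empty), each inducing a clique in $G$, such that $S_0$ is complete to $S_1\cup S_2$ and $S_1$ is anti-complete to $S_2$. Then $|S_0|+|S_1|+|S_2|\le t-1$.
   Context: All graphs are finite and simple. $\alpha(G)$ is the independence number. A matching $M$ in $G$ is connected if for every two edges of $M$ there is an edge of $G$ joining an endpoint of one to an endpoint of the other; $\mathrm{cm}(G)$ is the maximum size of a connected matching in $G$. For disjoint vertex sets $A,B$: $A$ is complete to $B$ if every vertex of $A$ is adjacent to every vertex of $B$; $A$ is anti-complete to $B$ if there is no edge between them. -}

module Defs where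

open import Data.Fin.Base using (Fin)
open import Data.Fin.Subset using (Subset; _∈_; ∣_∣)
open import Data.List.Base using (List; length)
open import Data.List.Relation.Unary.All using (All)
open import Data.List.Relation.Unary.AllPairs using (AllPairs)
open import Data.Nat.Base using (ℕ; _≤_)
open import Data.Product.Base using (_×_; _,_; ∃-syntax)
open import Data.Sum.Base using (_⊎_)
open import Level using (0ℓ)
open import Relation.Binary.Core using (Rel)
open import Relation.Binary.Definitions using (Decidable; Irreflexive; Symmetric)
open import Relation.Binary.PropositionalEquality.Core using (_≡_; _≢_)
open import Relation.Nullary.Negation.Core using (¬_)

-- Adjacency is required to be decidable, as it always is classically.
record Graph (n : ℕ) : Set₁ where
  field
    Adj    : Rel (Fin n) 0ℓ
    adj?   : Decidable Adj
    sym    : Symmetric Adj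
    irrefl : Irreflexive _≡_ Adj

IsMaximum : (ℕ → Set) → ℕ → Set
IsMaximum P k = P k × (∀ m → P m → m ≤ k)

-- An edge is represented by its two endpoints in either order.
Pair : ℕ → Set
Pair n = Fin n × Fin n

_EndpointOf_ : ∀ {n} → Fin n → Pair n → Set
u EndpointOf (a , b) = u ≡ a ⊎ u ≡ b

VertexDisjoint : ∀ {n} → Rel (Pair n) 0ℓ
VertexDisjoint e f = ∀ {u} → u EndpointOf e → ¬ (u EndpointOf f)

module _ {n : ℕ} (G : Graph n) where
  open Graph G

  IsEdge : Pair n → Set
  IsEdge (a , b) = Adj a b

  IsIndependent : Subset n → Set
  IsIndependent S = ∀ {u v} → u ∈ S → v ∈ S → ¬ Adj u v

  IsClique : Subset n → Set
  IsClique S = ∀ {u v} → u ∈ S → v ∈ S → u ≢ v → Adj u v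

  CompleteTo : Subset n → Subset n → Set
  CompleteTo A B = ∀ {a b} → a ∈ A → b ∈ B → Adj a b

  AnticompleteTo : Subset n → Subset n → Set
  AnticompleteTo A B = ∀ {a b} → a ∈ A → b ∈ B → ¬ Adj a b

  IsIndependenceNumber : ℕ → Set
  IsIndependenceNumber =
    IsMaximum λ k → ∃[ S ] (IsIndependent S × ∣ S ∣ ≡ k)

  -- Vertex-disjointness excludes repeated edges (in either orientation), so
  -- the length of the list is the number of edges of the matching.
  IsMatching : List (Pair n) → Set
  IsMatching M = All IsEdge M × AllPairs VertexDisjoint M

  JoinedByEdge : Rel (Pair n) 0ℓ
  JoinedByEdge e f =
    ∃[ u ] ∃[ v ] (u EndpointOf e × v EndpointOf f × Adj u v)

  -- JoinedByEdge is symmetric, so the order of the list is immaterial.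
  IsConnectedMatching : List (Pair n) → Set
  IsConnectedMatching M = IsMatching M × AllPairs JoinedByEdge M

  IsConnectedMatchingNumber : ℕ → Set
  IsConnectedMatchingNumber =
    IsMaximum λ k → ∃[ M ] (IsConnectedMatching M × length M ≡ k)

{-# OPTIONS --safe #-}

-- Since α(G) = 2, the non-neighbours of any vertex x form a clique, so a bound
-- on clique sizes is a lower bound on degrees, and greedy matching suffices.
--
-- Cliques: 2t vertices of a clique pair up into a connected matching, so all
-- cliques have fewer than 2t vertices.  If K is a clique of size t, every vertex
-- of K then has at least t neighbours outside K, and K is matched greedily into
-- its complement.  Hence all cliques have at most t - 1 vertices.
--
-- Now suppose |S₀| + |S₁| + |S₂| = t, and let U be the union.  A vertex outside
-- U cannot miss both a vertex of S₁ and a vertex of S₂, so V - U is covered by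
-- the sets Dᵢ of vertices complete to Sᵢ.  Matching S₂ into D₁ and S₀ ∪ S₁
-- anywhere outside U gives a connected matching, and the greedy choice succeeds
-- if |D₁| + |S₁| ≥ t - 1 + |S₂|.  If this fails, and also fails with S₁ and S₂
-- exchanged, then |D₁| + |D₂| < 2t - 2, too few to cover V - U.
module Submission where

open import Defs
open import Data.Fin.Base using (Fin; zero; suc)
open import Data.Fin.Properties using (_≟_; all?; suc-injective)
open import Data.Fin.Subset
  using (Subset; inside; outside; _∈_; _∉_; _⊆_; Empty; ⁅_⁆; ⊥; ⊤; _∩_; _∪_; _─_; _-_; ∣_∣)
open import Data.Fin.Subset.Properties
  using (_∈?_; Empty-unique; ∣⊥∣≡0; ∣⊤∣≡n; ∣⁅x⁆∣≡1; x∈⁅x⁆; x∈⁅y⁆⇒x≡y; p⊆q⇒∣p∣≤∣q∣;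
         x∈p∩q⁺; x∈p∩q⁻; ∩-comm; x∈p∪q⁺; x∈p∪q⁻; p─q⊆p; x∈p∧x∉q⇒x∈p─q; nonempty?)
open import Data.List.Base using (List; []; _∷_; _++_; map; length)
open import Data.List.Membership.Propositional using () renaming (_∈_ to _∈ˡ_)
open import Data.List.Membership.Propositional.Properties using (∈-++⁻)
open import Data.List.Properties using (length-map; length-++; ++-identityʳ)
open import Data.List.Relation.Unary.All as All using (All; []; _∷_)
import Data.List.Relation.Unary.All.Properties as All
open import Data.List.Relation.Unary.AllPairs as AllPairs using (AllPairs; []; _∷_)
import Data.List.Relation.Unary.AllPairs.Properties as AllPairs
open import Data.List.Relation.Unary.Unique.Propositional using (Unique)
import Data.List.Relation.Unary.Unique.Propositional.Properties as Unique
open import Data.Nat.Base using (ℕ; zero; suc; NonZero; _+_; _*_; _∸_; _⊓_; _≤_; _<_; z≤n; s≤s; s≤s⁻¹)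
open import Data.Nat.Properties hiding (_≟_; suc-injective)
open import Data.Nat.Tactic.RingSolver using (solve-∀)
open import Data.Product.Base using (_×_; _,_; proj₁; proj₂; ∃-syntax)
open import Data.Sum.Base using (_⊎_; inj₁; inj₂; [_,_]′)
open import Data.Vec.Base using ([]; _∷_; tabulate)
import Data.Vec.Base as Vec
open import Data.Vec.Properties using (lookup∘tabulate; []=⇒lookup; lookup⇒[]=)
open import Function.Base using (_∘_; id; case_of_)
open import Relation.Binary.PropositionalEquality
  using (_≡_; _≢_; refl; sym; trans; cong; cong₂; subst; module ≡-Reasoning)
open import Relation.Nullary using (yes; no; does; ¬_; contradiction)
open import Relation.Nullary.Decidable using (_×-dec_; _→-dec_; ¬?; dec-true; decidable-stable)
open import Relation.Unary using (Decidable)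

private
  variable
    n k : ℕ

-- Finite sets

⟦_⟧ : {P : Fin n → Set} → Decidable P → Subset n
⟦ P? ⟧ = tabulate (does ∘ P?)

module _ {P : Fin n → Set} (P? : Decidable P) {x : Fin n} where

  ∈⟦⟧⁺ : P x → x ∈ ⟦ P? ⟧
  ∈⟦⟧⁺ px = lookup⇒[]= x ⟦ P? ⟧ (trans (lookup∘tabulate (does ∘ P?) x) (dec-true (P? x) px))

  ∈⟦⟧⁻ : x ∈ ⟦ P? ⟧ → P x
  ∈⟦⟧⁻ x∈ with P? x | trans (sym (lookup∘tabulate (does ∘ P?) x)) ([]=⇒lookup x∈)
  ... | yes px | _ = px

∣p∪q∣+∣p∩q∣≡∣p∣+∣q∣ : (p q : Subset n) → ∣ p ∪ q ∣ + ∣ p ∩ q ∣ ≡ ∣ p ∣ + ∣ q ∣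
∣p∪q∣+∣p∩q∣≡∣p∣+∣q∣ []            []            = refl
∣p∪q∣+∣p∩q∣≡∣p∣+∣q∣ (outside ∷ p) (outside ∷ q) = ∣p∪q∣+∣p∩q∣≡∣p∣+∣q∣ p q
∣p∪q∣+∣p∩q∣≡∣p∣+∣q∣ (outside ∷ p) (inside  ∷ q) =
  trans (cong suc (∣p∪q∣+∣p∩q∣≡∣p∣+∣q∣ p q)) (sym (+-suc _ _))
∣p∪q∣+∣p∩q∣≡∣p∣+∣q∣ (inside  ∷ p) (outside ∷ q) = cong suc (∣p∪q∣+∣p∩q∣≡∣p∣+∣q∣ p q)
∣p∪q∣+∣p∩q∣≡∣p∣+∣q∣ (inside  ∷ p) (inside  ∷ q) =
  cong suc (trans (+-suc _ _) (trans (cong suc (∣p∪q∣+∣p∩q∣≡∣p∣+∣q∣ p q)) (sym (+-suc _ _))))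

∣p∪q∣≤∣p∣+∣q∣ : (p q : Subset n) → ∣ p ∪ q ∣ ≤ ∣ p ∣ + ∣ q ∣
∣p∪q∣≤∣p∣+∣q∣ p q = ≤-trans (m≤m+n _ _) (≤-reflexive (∣p∪q∣+∣p∩q∣≡∣p∣+∣q∣ p q))

∣p∪q∪r∣≤∣p∣+∣q∣+∣r∣ : (p q r : Subset n) → ∣ p ∪ q ∪ r ∣ ≤ ∣ p ∣ + ∣ q ∣ + ∣ r ∣
∣p∪q∪r∣≤∣p∣+∣q∣+∣r∣ p q r = begin
  ∣ p ∪ q ∪ r ∣             ≤⟨ ∣p∪q∣≤∣p∣+∣q∣ p (q ∪ r) ⟩
  ∣ p ∣ + ∣ q ∪ r ∣         ≤⟨ +-monoʳ-≤ ∣ p ∣ (∣p∪q∣≤∣p∣+∣q∣ q r) ⟩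
  ∣ p ∣ + (∣ q ∣ + ∣ r ∣)   ≡⟨ +-assoc ∣ p ∣ _ _ ⟨
  ∣ p ∣ + ∣ q ∣ + ∣ r ∣     ∎
  where open ≤-Reasoning

disjoint⇒∣p∣+∣q∣≡∣p∪q∣ : (p q : Subset n) → Empty (p ∩ q) → ∣ p ∣ + ∣ q ∣ ≡ ∣ p ∪ q ∣
disjoint⇒∣p∣+∣q∣≡∣p∪q∣ {n} p q p∩q=∅ = begin
  ∣ p ∣ + ∣ q ∣           ≡⟨ ∣p∪q∣+∣p∩q∣≡∣p∣+∣q∣ p q ⟨
  ∣ p ∪ q ∣ + ∣ p ∩ q ∣   ≡⟨ cong (λ r → ∣ p ∪ q ∣ + ∣ r ∣) (Empty-unique p∩q=∅) ⟩
  ∣ p ∪ q ∣ + ∣ ⊥ {n} ∣ ≡⟨ cong (∣ p ∪ q ∣ +_) (∣⊥∣≡0 n) ⟩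
  ∣ p ∪ q ∣ + 0           ≡⟨ +-identityʳ _ ⟩
  ∣ p ∪ q ∣               ∎
  where open ≡-Reasoning

x∈p─q⇒x∉q : (p q : Subset n) {x : Fin n} → x ∈ p ─ q → x ∉ q
x∈p─q⇒x∉q (_ ∷ p) (outside ∷ q) (Vec.there x∈) (Vec.there x∈q) = x∈p─q⇒x∉q p q x∈ x∈q
x∈p─q⇒x∉q (_ ∷ p) (inside  ∷ q) (Vec.there x∈) (Vec.there x∈q) = x∈p─q⇒x∉q p q x∈ x∈q

p⊆q∪[p─q] : (p q : Subset n) → p ⊆ q ∪ (p ─ q)
p⊆q∪[p─q] p q {x} x∈p with x ∈? q
... | yes x∈q = x∈p∪q⁺ (inj₁ x∈q)
... | no  x∉q = x∈p∪q⁺ (inj₂ (x∈p∧x∉q⇒x∈p─q x∈p x∉q))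

∣p∣≤∣q∣+∣p─q∣ : (p q : Subset n) → ∣ p ∣ ≤ ∣ q ∣ + ∣ p ─ q ∣
∣p∣≤∣q∣+∣p─q∣ p q = ≤-trans (p⊆q⇒∣p∣≤∣q∣ (p⊆q∪[p─q] p q)) (∣p∪q∣≤∣p∣+∣q∣ q (p ─ q))

cover : (p q r : Subset n) → (∀ x → x ∈ p ⊎ x ∈ q ⊎ x ∈ r) → n ≤ ∣ p ∣ + ∣ q ∣ + ∣ r ∣
cover {n} p q r covers = begin
  n                       ≡⟨ ∣⊤∣≡n n ⟨
  ∣ ⊤ {n} ∣               ≤⟨ p⊆q⇒∣p∣≤∣q∣ {p = ⊤} (λ {x} _ → ∈∪ (covers x)) ⟩
  ∣ p ∪ q ∪ r ∣           ≤⟨ ∣p∪q∪r∣≤∣p∣+∣q∣+∣r∣ p q r ⟩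
  ∣ p ∣ + ∣ q ∣ + ∣ r ∣   ∎
  where
  open ≤-Reasoning
  ∈∪ : ∀ {x} → x ∈ p ⊎ x ∈ q ⊎ x ∈ r → x ∈ p ∪ q ∪ r
  ∈∪ (inj₁ x∈p)  = x∈p∪q⁺ (inj₁ x∈p)
  ∈∪ (inj₂ x∈qr) = x∈p∪q⁺ (inj₂ (x∈p∪q⁺ x∈qr))

subsetOfSize : (p : Subset n) → k ≤ ∣ p ∣ → ∃[ q ] (q ⊆ p × ∣ q ∣ ≡ k)
subsetOfSize []            z≤n  = [] , id , refl
subsetOfSize (outside ∷ p) k≤p with subsetOfSize p k≤p
... | q , q⊆p , ∣q∣≡k = outside ∷ q , (λ { (Vec.there x∈q) → Vec.there (q⊆p x∈q) }) , ∣q∣≡k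
subsetOfSize {k = zero} (inside ∷ p) _ with subsetOfSize p z≤n
... | q , q⊆p , ∣q∣≡0 = outside ∷ q , (λ { (Vec.there x∈q) → Vec.there (q⊆p x∈q) }) , ∣q∣≡0
subsetOfSize {k = suc k} (inside ∷ p) (s≤s k≤p) with subsetOfSize p k≤p
... | q , q⊆p , ∣q∣≡k =
  inside ∷ q , (λ { Vec.here → Vec.here ; (Vec.there x∈q) → Vec.there (q⊆p x∈q) }) , cong suc ∣q∣≡k

elements : Subset n → List (Fin n)
elements []            = []
elements (inside  ∷ p) = zero ∷ map suc (elements p)
elements (outside ∷ p) = map suc (elements p)

length-elements : (p : Subset n) → length (elements p) ≡ ∣ p ∣
length-elements []            = refl
length-elements (inside  ∷ p) = cong suc (trans (length-map suc (elements p)) (length-elements p))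
length-elements (outside ∷ p) = trans (length-map suc (elements p)) (length-elements p)

elements-All : (p : Subset n) → All (_∈ p) (elements p)
elements-All []            = []
elements-All (inside  ∷ p) = Vec.here ∷ All.map⁺ (All.map Vec.there (elements-All p))
elements-All (outside ∷ p) = All.map⁺ (All.map Vec.there (elements-All p))

elements-Unique : (p : Subset n) → Unique (elements p)
elements-Unique []            = []
elements-Unique (inside  ∷ p) =
  All.map⁺ (All.universal (λ _ ()) (elements p)) ∷ Unique.map⁺ suc-injective (elements-Unique p)
elements-Unique (outside ∷ p) = Unique.map⁺ suc-injective (elements-Unique p)

-- Pigeonhole by induction on `ys`: deleting the head `z` from `p` costs at most one element, so the
-- strict inequality survives, and any element of `p - z` differs from `z`.
∃-avoiding : (p : Subset n) (ys : List (Fin n)) → length ys < ∣ p ∣ → ∃[ y ] (y ∈ p × All (y ≢_) ys)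
∃-avoiding {n} p [] 0<∣p∣ with nonempty? p
... | yes (y , y∈p) = y , y∈p , []
... | no  p=∅       = contradiction 0<∣p∣ (≤⇒≯ (≤-reflexive (trans (cong ∣_∣ (Empty-unique p=∅)) (∣⊥∣≡0 n))))
∃-avoiding p (z ∷ ys) ys<p
  with ∃-avoiding (p - z) ys (s≤s⁻¹ (≤-trans ys<p
         (subst (λ m → ∣ p ∣ ≤ m + ∣ p - z ∣) (∣⁅x⁆∣≡1 z) (∣p∣≤∣q∣+∣p─q∣ p ⁅ z ⁆))))
... | y , y∈p-z , y∉ys =
  y , p─q⊆p p ⁅ z ⁆ y∈p-z , (λ { refl → x∈p─q⇒x∉q p ⁅ z ⁆ y∈p-z (x∈⁅x⁆ z) }) ∷ y∉ys

-- Greedy matching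

-- Witnessed by a subset instead of a count of the solutions, so that `P` may be any predicate,
-- decidable or not.
AtLeast : ℕ → (Fin n → Set) → Set
AtLeast k P = ∃[ p ] (k ≤ ∣ p ∣ × (∀ {y} → y ∈ p → P y))

-- A system of distinct representatives: each entry of `xs` receives its own second endpoint. `Q`
-- can demand more than adjacency, and so carries what connectedness later requires of each pair.
record Partners (Q : Fin n → Fin n → Set) (xs : List (Fin n)) : Set where
  field
    pairs   : List (Pair n)
    firsts  : map proj₁ pairs ≡ xs
    seconds : Unique (map proj₂ pairs)
    related : All (λ e → Q (proj₁ e) (proj₂ e)) pairs

module _ {Q : Fin n → Fin n → Set} where

  noPartners : Partners Q []
  noPartners = record { pairs = [] ; firsts = refl ; seconds = [] ; related = [] }

  consPartners : ∀ {x xs} → AtLeast (suc (length xs)) (Q x) → Partners Q xs → Partners Q (x ∷ xs)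
  consPartners {x} {xs} (p , xs<p , p⊆Q) M = add (∃-avoiding p (map proj₂ pairs) seconds<p)
    where
    open Partners M
    open ≤-Reasoning
    seconds<p : length (map proj₂ pairs) < ∣ p ∣
    seconds<p = begin-strict
      length (map proj₂ pairs)   ≡⟨ length-map proj₂ pairs ⟩
      length pairs               ≡⟨ length-map proj₁ pairs ⟨
      length (map proj₁ pairs)   ≡⟨ cong length firsts ⟩
      length xs                  <⟨ xs<p ⟩
      ∣ p ∣                      ∎
    add : ∃[ y ] (y ∈ p × All (y ≢_) (map proj₂ pairs)) → Partners Q (x ∷ xs)
    add (y , y∈p , y∉) = record
      { pairs   = (x , y) ∷ pairs
      ; firsts  = cong (x ∷_) firsts
      ; seconds = y∉ ∷ seconds
      ; related = p⊆Q y∈p ∷ related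
      }

  -- When an entry of `xs` is treated, fewer than `k` second endpoints are taken, so one of its `k`
  -- candidates is free. The vertices `ys` come with partners already, so those with few candidates
  -- can be served first.
  extendPartners : ∀ xs {ys} → length xs + length ys ≤ k → All (λ x → AtLeast k (Q x)) xs →
                   Partners Q ys → Partners Q (xs ++ ys)
  extendPartners []       _    _                              M = M
  extendPartners (x ∷ xs) size ((p , k≤∣p∣ , p⊆Q) ∷ choices) M =
    consPartners
      (p , ≤-trans (s≤s (≤-reflexive (length-++ xs))) (≤-trans size k≤∣p∣) , p⊆Q)
      (extendPartners xs (≤-trans (n≤1+n _) size) choices M)

-- Connected matchings

-- Serves to combine what is known of each pair of a matching with the distinctness of endpoints,
-- giving vertex-disjointness and joinedness.
AllPairs-refine : {A : Set} {P : A → Set} {R S : A → A → Set} →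
                  (∀ {x y} → P x → P y → R x y → S x y) →
                  ∀ {xs} → All P xs → AllPairs R xs → AllPairs S xs
AllPairs-refine f []         []       = []
AllPairs-refine f (px ∷ pxs) (r ∷ rs) =
  All.zipWith (λ (py , rxy) → f px py rxy) (pxs , r) ∷ AllPairs-refine f pxs rs

module _ (G : Graph n) where
  open Graph G renaming (sym to Adj-sym)

  HasConnectedMatching : ℕ → Set
  HasConnectedMatching k = ∃[ M ] (IsConnectedMatching G M × length M ≡ k)

  -- First endpoints lie in `U` and second endpoints outside it, so two pairs could only share a
  -- first or a second endpoint; both lists of endpoints are free of repetitions.
  partners⇒connectedMatching :
    {Q : Fin n → Fin n → Set} (U : Subset n) {xs : List (Fin n)} →
    Unique xs → All (_∈ U) xs →
    (∀ {x y} → Q x y → Adj x y) → (∀ {x y} → Q x y → y ∉ U) →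
    (∀ {x y x′ y′} → Q x y → Q x′ y′ → x ≢ x′ → JoinedByEdge G (x , y) (x′ , y′)) →
    Partners Q xs → HasConnectedMatching (length xs)
  partners⇒connectedMatching {Q} U {xs} xs! xs⊆U adj outsideU joined M =
    pairs , ((All.map adj related , AllPairs-refine disjoint good distinct)
            , AllPairs-refine (λ (_ , q) (_ , q′) (x≢x′ , _) → joined q q′ x≢x′) good distinct)
    , trans (sym (length-map proj₁ pairs)) (cong length firsts)
    where
    open Partners M
    good : All (λ e → proj₁ e ∈ U × Q (proj₁ e) (proj₂ e)) pairs
    good = All.zip (All.map⁻ (subst (All (_∈ U)) (sym firsts) xs⊆U) , related)
    distinct : AllPairs (λ e f → proj₁ e ≢ proj₁ f × proj₂ e ≢ proj₂ f) pairs
    distinct = AllPairs.zip (AllPairs.map⁻ (subst Unique (sym firsts) xs!) , AllPairs.map⁻ seconds)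
    disjoint : ∀ {e f} → proj₁ e ∈ U × Q (proj₁ e) (proj₂ e) → proj₁ f ∈ U × Q (proj₁ f) (proj₂ f) →
               proj₁ e ≢ proj₁ f × proj₂ e ≢ proj₂ f → VertexDisjoint e f
    disjoint _          _          (x≢x′ , _) (inj₁ refl) (inj₁ x≡x′) = x≢x′ x≡x′
    disjoint (x∈U , _)  (_ , q′)   _          (inj₁ refl) (inj₂ refl) = outsideU q′ x∈U
    disjoint (_ , q)    (x′∈U , _) _          (inj₂ refl) (inj₁ refl) = outsideU q x′∈U
    disjoint _          _          (_ , y≢y′) (inj₂ refl) (inj₂ y≡y′) = y≢y′ y≡y′

  neighbours : Fin n → Subset n
  neighbours x = ⟦ adj? x ⟧

  -- Any matching from a clique to its complement is connected, since two first endpoints are always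
  -- adjacent. With `∣ K ∣` outside neighbours per vertex the greedy choice never gets stuck.
  matchClique : (K : Subset n) → IsClique G K →
                (∀ {x} → x ∈ K → ∣ K ∣ ≤ ∣ neighbours x ─ K ∣) → HasConnectedMatching ∣ K ∣
  matchClique K clique degree =
    subst HasConnectedMatching (length-elements K)
      (partners⇒connectedMatching {Q} K (elements-Unique K) (elements-All K)
        (λ (_ , a , _) → a) (λ (_ , _ , y∉K) → y∉K)
        (λ (x∈K , _) (x′∈K , _) x≢x′ → _ , _ , inj₁ refl , inj₁ refl , clique x∈K x′∈K x≢x′)
        (subst (Partners Q) (++-identityʳ _)
          (extendPartners (elements K) (≤-reflexive (trans (+-identityʳ _) (length-elements K)))
            (All.map choices (elements-All K)) noPartners)))
    where
    Q : Fin n → Fin n → Set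
    Q x y = x ∈ K × Adj x y × y ∉ K
    choices : ∀ {x} → x ∈ K → AtLeast ∣ K ∣ (Q x)
    choices {x} x∈K = neighbours x ─ K , degree x∈K ,
      λ y∈ → x∈K , ∈⟦⟧⁻ (adj? x) (p─q⊆p (neighbours x) K y∈) , x∈p─q⇒x∉q (neighbours x) K y∈

  -- Half of a large clique is matched into the other half.
  matchLargeClique : (K : Subset n) → IsClique G K → k + k ≤ ∣ K ∣ → HasConnectedMatching k
  matchLargeClique {k} K clique 2k≤∣K∣ with subsetOfSize K (≤-trans (m≤m+n k k) 2k≤∣K∣)
  ... | H , H⊆K , refl = matchClique H (λ u∈H v∈H → clique (H⊆K u∈H) (H⊆K v∈H)) λ {x} x∈H →
    ≤-trans (+-cancelˡ-≤ ∣ H ∣ _ _ (≤-trans 2k≤∣K∣ (∣p∣≤∣q∣+∣p─q∣ K H)))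
      (p⊆q⇒∣p∣≤∣q∣ λ y∈K─H → x∈p∧x∉q⇒x∈p─q
        (∈⟦⟧⁺ (adj? x) (clique (H⊆K x∈H) (p─q⊆p K H y∈K─H) λ { refl → x∈p─q⇒x∉q K H y∈K─H x∈H }))
        (x∈p─q⇒x∉q K H y∈K─H))

  -- Non-neighbours, common neighbours and independence number two

  nonNeighbour? : ∀ x → Decidable (λ v → x ≢ v × ¬ Adj x v)
  nonNeighbour? x v = ¬? (x ≟ v) ×-dec ¬? (adj? x v)

  nonNeighbours : Fin n → Subset n
  nonNeighbours x = ⟦ nonNeighbour? x ⟧

  n≤∣U∣+∣N─U∣+∣nonN∣ : (U : Subset n) {x : Fin n} → x ∈ U →
                       n ≤ ∣ U ∣ + ∣ neighbours x ─ U ∣ + ∣ nonNeighbours x ∣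
  n≤∣U∣+∣N─U∣+∣nonN∣ U {x} x∈U = cover U (neighbours x ─ U) (nonNeighbours x) covers
    where
    covers : ∀ v → v ∈ U ⊎ v ∈ neighbours x ─ U ⊎ v ∈ nonNeighbours x
    covers v with v ∈? U | adj? x v
    ... | yes v∈U | _      = inj₁ v∈U
    ... | no  v∉U | yes xv = inj₂ (inj₁ (x∈p∧x∉q⇒x∈p─q (∈⟦⟧⁺ (adj? x) xv) v∉U))
    -- Non-neighbours exclude `x` itself; this `v` differs from `x` because `x` lies in `U`.
    ... | no  v∉U | no ¬xv = inj₂ (inj₂ (∈⟦⟧⁺ (nonNeighbour? x) ((λ { refl → v∉U x∈U }) , ¬xv)))

  commonNeighbour? : (S : Subset n) → Decidable (λ v → ∀ a → a ∈ S → Adj a v)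
  commonNeighbour? S v = all? λ a → (a ∈? S) →-dec adj? a v

  commonNeighbours : Subset n → Subset n
  commonNeighbours S = ⟦ commonNeighbour? S ⟧

  module _ (α≡2 : IsIndependenceNumber G 2) where

    -- Were `v` and `w` non-adjacent as well, the three vertices would form an independent set of
    -- size 3, against the maximality in `α≡2`.
    ¬Adj⇒Adj : ∀ {u v w} → u ≢ v → u ≢ w → v ≢ w → ¬ Adj u v → ¬ Adj u w → Adj v w
    ¬Adj⇒Adj {u} {v} {w} u≢v u≢w v≢w ¬uv ¬uw = decidable-stable (adj? v w) λ ¬vw →
      <⇒≱ (≤-reflexive (sym ∣T∣≡3)) (proj₂ α≡2 ∣ T ∣ (T , independent ¬vw , refl))
      where
      T : Subset n
      T = ⁅ u ⁆ ∪ ⁅ v ⁆ ∪ ⁅ w ⁆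
      cases : ∀ {x} → x ∈ T → x ≡ u ⊎ x ≡ v ⊎ x ≡ w
      cases x∈T with x∈p∪q⁻ ⁅ u ⁆ _ x∈T
      ... | inj₁ x∈u = inj₁ (x∈⁅y⁆⇒x≡y u x∈u)
      ... | inj₂ x∈vw with x∈p∪q⁻ ⁅ v ⁆ _ x∈vw
      ...   | inj₁ x∈v = inj₂ (inj₁ (x∈⁅y⁆⇒x≡y v x∈v))
      ...   | inj₂ x∈w = inj₂ (inj₂ (x∈⁅y⁆⇒x≡y w x∈w))
      independent : ¬ Adj v w → IsIndependent G T
      independent ¬vw x∈T y∈T with cases x∈T | cases y∈T
      ... | inj₁ refl        | inj₁ refl        = irrefl refl
      ... | inj₁ refl        | inj₂ (inj₁ refl) = ¬uv
      ... | inj₁ refl        | inj₂ (inj₂ refl) = ¬uw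
      ... | inj₂ (inj₁ refl) | inj₁ refl        = ¬uv ∘ Adj-sym
      ... | inj₂ (inj₁ refl) | inj₂ (inj₁ refl) = irrefl refl
      ... | inj₂ (inj₁ refl) | inj₂ (inj₂ refl) = ¬vw
      ... | inj₂ (inj₂ refl) | inj₁ refl        = ¬uw ∘ Adj-sym
      ... | inj₂ (inj₂ refl) | inj₂ (inj₁ refl) = ¬vw ∘ Adj-sym
      ... | inj₂ (inj₂ refl) | inj₂ (inj₂ refl) = irrefl refl
      ∣insert∣ : ∀ {y} {S : Subset n} → y ∉ S → ∣ ⁅ y ⁆ ∪ S ∣ ≡ suc ∣ S ∣
      ∣insert∣ {y} {S} y∉S = trans
        (sym (disjoint⇒∣p∣+∣q∣≡∣p∪q∣ ⁅ y ⁆ S λ (x , x∈) → y∉S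
          (subst (_∈ S) (x∈⁅y⁆⇒x≡y y (proj₁ (x∈p∩q⁻ ⁅ y ⁆ S x∈))) (proj₂ (x∈p∩q⁻ ⁅ y ⁆ S x∈)))))
        (cong (_+ ∣ S ∣) (∣⁅x⁆∣≡1 y))
      ∣T∣≡3 : ∣ T ∣ ≡ 3
      ∣T∣≡3 = trans (∣insert∣ u∉vw) (cong suc (trans (∣insert∣ (v≢w ∘ x∈⁅y⁆⇒x≡y w)) (cong suc (∣⁅x⁆∣≡1 w))))
        where
        u∉vw : u ∉ ⁅ v ⁆ ∪ ⁅ w ⁆
        u∉vw u∈ = [ u≢v ∘ x∈⁅y⁆⇒x≡y v , u≢w ∘ x∈⁅y⁆⇒x≡y w ]′ (x∈p∪q⁻ ⁅ v ⁆ ⁅ w ⁆ u∈)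

    nonNeighbours-clique : ∀ x → IsClique G (nonNeighbours x)
    nonNeighbours-clique x u∈ v∈ u≢v with ∈⟦⟧⁻ (nonNeighbour? x) u∈ | ∈⟦⟧⁻ (nonNeighbour? x) v∈
    ... | x≢u , ¬xu | x≢v , ¬xv = ¬Adj⇒Adj x≢u x≢v u≢v ¬xu ¬xv

-- Three cliques in a graph on 4t - 1 vertices (t = s + 1)

module _ (s : ℕ) (G : Graph (s + 3 * suc s))
         (α≡2 : IsIndependenceNumber G 2) (noMatching : ¬ HasConnectedMatching G (suc s)) where
  open Graph G renaming (sym to Adj-sym)

  private
    t N : ℕ
    t = suc s
    -- The form to which `4 * suc s ∸ 1` computes, so that the vertex count of the final theorem can
    -- be matched with `refl`.
    N = s + 3 * t

  clique-<2t : (K : Subset N) → IsClique G K → ∣ K ∣ < t + t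
  clique-<2t K clique = ≰⇒> (noMatching ∘ matchLargeClique G K clique)

  -- The weaker bound improves itself: non-neighbours form a clique of at most 2t - 1 vertices, so a
  -- vertex of a clique `H` of size t has at least (4t - 1) - t - (2t - 1) = t neighbours outside
  -- `H`.
  clique-≤s : (K : Subset N) → IsClique G K → ∣ K ∣ ≤ s
  clique-≤s K clique = ≮⇒≥ λ t≤∣K∣ → case subsetOfSize K t≤∣K∣ of λ
    (H , H⊆K , ∣H∣≡t) → noMatching (subst (HasConnectedMatching G) ∣H∣≡t
      (matchClique G H (λ u∈H v∈H → clique (H⊆K u∈H) (H⊆K v∈H)) (degree H ∣H∣≡t)))
    where
    degree : ∀ H → ∣ H ∣ ≡ t → ∀ {x} → x ∈ H → ∣ H ∣ ≤ ∣ neighbours G x ─ H ∣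
    degree H ∣H∣≡t {x} x∈H = subst (_≤ d) (sym ∣H∣≡t) (+-cancelʳ-≤ (t + (s + t)) t d (begin
      t + (t + (s + t))                      ≡⟨ shuffle s ⟩
      N                                      ≤⟨ n≤∣U∣+∣N─U∣+∣nonN∣ G H x∈H ⟩
      ∣ H ∣ + d + ∣ nonNeighbours G x ∣      ≤⟨ +-mono-≤ (≤-reflexive (cong (_+ d) ∣H∣≡t))
                                                  (s≤s⁻¹ (clique-<2t _ (nonNeighbours-clique G α≡2 x))) ⟩
      t + d + (s + t)                        ≡⟨ regroup t d (s + t) ⟩
      d + (t + (s + t))                      ∎))
      where
      open ≤-Reasoning
      d = ∣ neighbours G x ─ H ∣
      shuffle : ∀ s → suc s + (suc s + (s + suc s)) ≡ s + 3 * suc s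
      shuffle = solve-∀
      regroup : ∀ a b c → a + b + c ≡ b + (a + c)
      regroup = solve-∀

  -- The useful second endpoints: an edge ending in `D U S` is joined to every matching edge that
  -- starts in `S`.
  D : Subset N → Subset N → Subset N
  D U S = commonNeighbours G S ─ U

  module _ (U : Subset N) (∣U∣≤t : ∣ U ∣ ≤ t) where

    t≤∣N─U∣ : ∀ {x} → x ∈ U → t ≤ ∣ neighbours G x ─ U ∣
    -- The count gives (4t - 1) - t - (t - 1) = 2t, which is then weakened to t.
    t≤∣N─U∣ {x} x∈U = ≤-trans (m≤m+n t t) (+-cancelʳ-≤ (t + s) (t + t) d (begin
      t + t + (t + s)                        ≡⟨ shuffle s ⟩
      N                                      ≤⟨ n≤∣U∣+∣N─U∣+∣nonN∣ G U x∈U ⟩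
      ∣ U ∣ + d + ∣ nonNeighbours G x ∣      ≤⟨ +-mono-≤ (+-monoˡ-≤ d ∣U∣≤t)
                                                  (clique-≤s _ (nonNeighbours-clique G α≡2 x)) ⟩
      t + d + s                              ≡⟨ regroup t d s ⟩
      d + (t + s)                            ∎))
      where
      open ≤-Reasoning
      d = ∣ neighbours G x ─ U ∣
      shuffle : ∀ s → suc s + suc s + (suc s + s) ≡ s + 3 * suc s
      shuffle = solve-∀
      regroup : ∀ a b c → a + b + c ≡ b + (a + c)
      regroup = solve-∀

    -- Two edges starting in `S₀ ∪ S₁`, two starting in `S₂`, or one starting in `S₀` and one in
    -- `S₂` are joined by their first endpoints. Only an edge from `S₁` and one from `S₂` need help,
    -- so the partners of `S₂` are taken from `D U S₁`; `large` ensures that enough of them exist.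
    matchThreeCliques :
      (S₀ S₁ S₂ : Subset N) → S₀ ⊆ U → S₁ ⊆ U → S₂ ⊆ U →
      ∣ S₀ ∣ + ∣ S₁ ∣ + ∣ S₂ ∣ ≡ t →
      Empty (S₀ ∩ S₁) → Empty (S₀ ∩ S₂) → Empty (S₁ ∩ S₂) →
      IsClique G S₀ → IsClique G S₁ → IsClique G S₂ →
      CompleteTo G S₀ S₁ → CompleteTo G S₀ S₂ → AnticompleteTo G S₁ S₂ →
      s + ∣ S₂ ∣ ≤ ∣ D U S₁ ∣ + ∣ S₁ ∣ → HasConnectedMatching G t
    matchThreeCliques S₀ S₁ S₂ S₀⊆U S₁⊆U S₂⊆U total S₀∩S₁ S₀∩S₂ S₁∩S₂
      clique₀ clique₁ clique₂ complete₁ complete₂ anticomplete large =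
      subst (HasConnectedMatching G) length≡t
        (partners⇒connectedMatching G {Q} U unique xs⊆U
          (λ (a , _) → a) (λ (_ , y∉U , _) → y∉U)
          (λ (_ , _ , r) (_ , _ , r′) → joined r r′)
          -- `S₂` stands at the end of the list and is therefore matched first, while its `∣ S₂ ∣`
          -- guaranteed candidates still suffice. The other vertices have `t` candidates each.
          (extendPartners (elements S₀ ++ elements S₁)
            (≤-reflexive (trans (sym (length-++ (elements S₀ ++ elements S₁))) length≡t))
            (All.++⁺ (All.map (λ x∈ → choices (λ _ → inj₁ x∈) (S₀⊆U x∈)) (elements-All S₀))
                     (All.map (λ x∈ → choices (λ _ → inj₂ (inj₁ x∈)) (S₁⊆U x∈)) (elements-All S₁)))
            (subst (Partners Q) (++-identityʳ _)
              (extendPartners (elements S₂) (≤-reflexive (trans (+-identityʳ _) (length-elements S₂)))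
                (All.map choices₂ (elements-All S₂)) noPartners))))
      where
      Role : Fin N → Fin N → Set
      Role x y = x ∈ S₀ ⊎ x ∈ S₁ ⊎ (x ∈ S₂ × ∀ a → a ∈ S₁ → Adj a y)

      Q : Fin N → Fin N → Set
      Q x y = Adj x y × y ∉ U × Role x y

      joined : ∀ {x y x′ y′} → Role x y → Role x′ y′ → x ≢ x′ → JoinedByEdge G (x , y) (x′ , y′)
      joined {x} {y} {x′} {y′} = go
        where
        byFirsts : Adj x x′ → JoinedByEdge G (x , y) (x′ , y′)
        byFirsts a = x , x′ , inj₁ refl , inj₁ refl , a
        go : Role x y → Role x′ y′ → x ≢ x′ → JoinedByEdge G (x , y) (x′ , y′)
        go (inj₁ x∈)              (inj₁ x′∈)              x≢x′ = byFirsts (clique₀ x∈ x′∈ x≢x′)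
        go (inj₁ x∈)              (inj₂ (inj₁ x′∈))       _    = byFirsts (complete₁ x∈ x′∈)
        go (inj₁ x∈)              (inj₂ (inj₂ (x′∈ , _))) _    = byFirsts (complete₂ x∈ x′∈)
        go (inj₂ (inj₁ x∈))       (inj₁ x′∈)              _    = byFirsts (Adj-sym (complete₁ x′∈ x∈))
        go (inj₂ (inj₁ x∈))       (inj₂ (inj₁ x′∈))       x≢x′ = byFirsts (clique₁ x∈ x′∈ x≢x′)
        -- The first endpoints are not adjacent here; the joining edge runs from the vertex of `S₁`
        -- to the second endpoint of the other pair.
        go (inj₂ (inj₁ x∈))       (inj₂ (inj₂ (_ , c′)))  _    =
          x , y′ , inj₁ refl , inj₂ refl , c′ x x∈
        go (inj₂ (inj₂ (x∈ , _))) (inj₁ x′∈)              _    = byFirsts (Adj-sym (complete₂ x′∈ x∈))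
        go (inj₂ (inj₂ (_ , c)))  (inj₂ (inj₁ x′∈))       _    =
          y , x′ , inj₂ refl , inj₁ refl , Adj-sym (c x′ x′∈)
        go (inj₂ (inj₂ (x∈ , _))) (inj₂ (inj₂ (x′∈ , _))) x≢x′ = byFirsts (clique₂ x∈ x′∈ x≢x′)

      choices : ∀ {x} → (∀ y → Role x y) → x ∈ U → AtLeast t (Q x)
      choices {x} role x∈U = neighbours G x ─ U , t≤∣N─U∣ x∈U , λ y∈ →
        ∈⟦⟧⁻ (adj? x) (p─q⊆p (neighbours G x) U y∈) , x∈p─q⇒x∉q (neighbours G x) U y∈ , role _

      -- The non-neighbours of `x` form a clique of at most s vertices that contains all of `S₁`,
      -- while `D U S₁` avoids `S₁`. Hence `x` misses at most s - `∣ S₁ ∣` vertices of `D U S₁`, and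
      -- `large` leaves `∣ S₂ ∣` of them.
      choices₂ : ∀ {x} → x ∈ S₂ → AtLeast ∣ S₂ ∣ (Q x)
      choices₂ {x} x∈S₂ = N∩D , enough , λ y∈ → case x∈p∩q⁻ (neighbours G x) (D U S₁) y∈ of λ
        (y∈N , y∈D) → ∈⟦⟧⁻ (adj? x) y∈N , x∈p─q⇒x∉q (commonNeighbours G S₁) U y∈D ,
          inj₂ (inj₂ (x∈S₂ , ∈⟦⟧⁻ (commonNeighbour? G S₁) (p─q⊆p (commonNeighbours G S₁) U y∈D)))
        where
        N∩D nonN : Subset N
        N∩D  = neighbours G x ∩ D U S₁
        nonN = nonNeighbours G x

        S₁⊆nonN : S₁ ⊆ nonN
        S₁⊆nonN a∈ = ∈⟦⟧⁺ (nonNeighbour? G x)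
          ((λ { refl → S₁∩S₂ (x , x∈p∩q⁺ (a∈ , x∈S₂)) }) , anticomplete a∈ x∈S₂ ∘ Adj-sym)

        D⊆ : D U S₁ ⊆ N∩D ∪ (nonN ─ S₁)
        D⊆ {v} v∈D with adj? x v
        ... | yes xv = x∈p∪q⁺ (inj₁ (x∈p∩q⁺ (∈⟦⟧⁺ (adj? x) xv , v∈D)))
        ... | no ¬xv = x∈p∪q⁺ (inj₂ (x∈p∧x∉q⇒x∈p─q
          (∈⟦⟧⁺ (nonNeighbour? G x) ((λ { refl → v∉U (S₂⊆U x∈S₂) }) , ¬xv)) (v∉U ∘ S₁⊆U)))
          where
          v∉U : v ∉ U
          v∉U = x∈p─q⇒x∉q (commonNeighbours G S₁) U v∈D

        ∣nonN─S₁∣+∣S₁∣≤s : ∣ nonN ─ S₁ ∣ + ∣ S₁ ∣ ≤ s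
        ∣nonN─S₁∣+∣S₁∣≤s = begin
          ∣ nonN ─ S₁ ∣ + ∣ S₁ ∣   ≡⟨ disjoint⇒∣p∣+∣q∣≡∣p∪q∣ (nonN ─ S₁) S₁ (λ (_ , v∈) →
                                        x∈p─q⇒x∉q nonN S₁ (proj₁ (x∈p∩q⁻ _ S₁ v∈)) (proj₂ (x∈p∩q⁻ _ S₁ v∈))) ⟩
          ∣ (nonN ─ S₁) ∪ S₁ ∣     ≤⟨ p⊆q⇒∣p∣≤∣q∣ ([ p─q⊆p nonN S₁ , S₁⊆nonN ]′ ∘ x∈p∪q⁻ (nonN ─ S₁) S₁) ⟩
          ∣ nonN ∣                 ≤⟨ clique-≤s nonN (nonNeighbours-clique G α≡2 x) ⟩
          s                        ∎
          where open ≤-Reasoning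

        enough : ∣ S₂ ∣ ≤ ∣ N∩D ∣
        enough = +-cancelˡ-≤ s _ _ (begin
          s + ∣ S₂ ∣                             ≤⟨ large ⟩
          ∣ D U S₁ ∣ + ∣ S₁ ∣                    ≤⟨ +-monoˡ-≤ ∣ S₁ ∣ (p⊆q⇒∣p∣≤∣q∣ D⊆) ⟩
          ∣ N∩D ∪ (nonN ─ S₁) ∣ + ∣ S₁ ∣         ≤⟨ +-monoˡ-≤ ∣ S₁ ∣ (∣p∪q∣≤∣p∣+∣q∣ N∩D (nonN ─ S₁)) ⟩
          ∣ N∩D ∣ + ∣ nonN ─ S₁ ∣ + ∣ S₁ ∣       ≡⟨ +-assoc ∣ N∩D ∣ _ _ ⟩
          ∣ N∩D ∣ + (∣ nonN ─ S₁ ∣ + ∣ S₁ ∣)     ≤⟨ +-monoʳ-≤ ∣ N∩D ∣ ∣nonN─S₁∣+∣S₁∣≤s ⟩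
          ∣ N∩D ∣ + s                            ≡⟨ +-comm ∣ N∩D ∣ s ⟩
          s + ∣ N∩D ∣                            ∎)
          where open ≤-Reasoning

      length≡t : length ((elements S₀ ++ elements S₁) ++ elements S₂) ≡ t
      length≡t = trans (length-++ (elements S₀ ++ elements S₁))
        (trans (cong₂ _+_ (trans (length-++ (elements S₀)) (cong₂ _+_ (length-elements S₀) (length-elements S₁)))
                          (length-elements S₂))
               total)

      xs⊆U : All (_∈ U) ((elements S₀ ++ elements S₁) ++ elements S₂)
      xs⊆U = All.++⁺ (All.++⁺ (All.map S₀⊆U (elements-All S₀)) (All.map S₁⊆U (elements-All S₁)))
                     (All.map S₂⊆U (elements-All S₂))

      unique : Unique ((elements S₀ ++ elements S₁) ++ elements S₂)
      unique = Unique.++⁺ (Unique.++⁺ (elements-Unique S₀) (elements-Unique S₁)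
                            λ (v∈₀ , v∈₁) → S₀∩S₁ (_ , x∈p∩q⁺ (elements⊆ S₀ v∈₀ , elements⊆ S₁ v∈₁)))
        (elements-Unique S₂) λ (v∈₀₁ , v∈₂) →
          [ (λ v∈₀ → S₀∩S₂ (_ , x∈p∩q⁺ (elements⊆ S₀ v∈₀ , elements⊆ S₂ v∈₂)))
          , (λ v∈₁ → S₁∩S₂ (_ , x∈p∩q⁺ (elements⊆ S₁ v∈₁ , elements⊆ S₂ v∈₂)))
          ]′ (∈-++⁻ (elements S₀) v∈₀₁)
        where
        elements⊆ : ∀ S {v} → v ∈ˡ elements S → v ∈ S
        elements⊆ S = All.lookup (elements-All S)

  -- A vertex outside U that is complete to neither S₁ nor S₂ would lie in an
  -- independent triple.
  n≤∣U∣+∣D∣+∣D∣ : (U S₁ S₂ : Subset N) → S₁ ⊆ U → S₂ ⊆ U →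
                  Empty (S₁ ∩ S₂) → AnticompleteTo G S₁ S₂ →
                  N ≤ ∣ U ∣ + ∣ D U S₁ ∣ + ∣ D U S₂ ∣
  n≤∣U∣+∣D∣+∣D∣ U S₁ S₂ S₁⊆U S₂⊆U S₁∩S₂ anticomplete = cover U _ _ covers
    where
    covers : ∀ v → v ∈ U ⊎ v ∈ D U S₁ ⊎ v ∈ D U S₂
    covers v with v ∈? U | commonNeighbour? G S₁ v
    ... | yes v∈U | _      = inj₁ v∈U
    ... | no  v∉U | yes c₁ = inj₂ (inj₁ (x∈p∧x∉q⇒x∈p─q (∈⟦⟧⁺ (commonNeighbour? G S₁) c₁) v∉U))
    ... | no  v∉U | no ¬c₁ = inj₂ (inj₂ (x∈p∧x∉q⇒x∈p─q (∈⟦⟧⁺ (commonNeighbour? G S₂) c₂) v∉U))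
      where
      c₂ : ∀ b → b ∈ S₂ → Adj b v
      c₂ b b∈ = decidable-stable (adj? b v) λ ¬bv → ¬c₁ λ a a∈ →
        ¬Adj⇒Adj G α≡2 (λ { refl → S₁∩S₂ (b , x∈p∩q⁺ (a∈ , b∈)) })
          (λ { refl → v∉U (S₂⊆U b∈) }) (λ { refl → v∉U (S₁⊆U a∈) })
          (anticomplete a∈ b∈ ∘ Adj-sym) ¬bv

  -- With total exactly `t`, matching the whole union yields a connected matching of precisely the
  -- forbidden size; larger totals are cut down to this one afterwards.
  ∣S₀∣+∣S₁∣+∣S₂∣≢t :
    (S₀ S₁ S₂ : Subset N) →
    Empty (S₀ ∩ S₁) → Empty (S₀ ∩ S₂) → Empty (S₁ ∩ S₂) →
    IsClique G S₀ → IsClique G S₁ → IsClique G S₂ →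
    CompleteTo G S₀ S₁ → CompleteTo G S₀ S₂ → AnticompleteTo G S₁ S₂ →
    ∣ S₀ ∣ + ∣ S₁ ∣ + ∣ S₂ ∣ ≢ t
  ∣S₀∣+∣S₁∣+∣S₂∣≢t S₀ S₁ S₂ S₀∩S₁ S₀∩S₂ S₁∩S₂
    clique₀ clique₁ clique₂ complete₁ complete₂ anticomplete total =
    <-irrefl refl (begin-strict
      N + (∣ S₁ ∣ + ∣ S₂ ∣)                           ≤⟨ +-monoˡ-≤ _
                                                           (n≤∣U∣+∣D∣+∣D∣ U S₁ S₂ S₁⊆U S₂⊆U S₁∩S₂ anticomplete) ⟩
      ∣ U ∣ + d₁ + d₂ + (∣ S₁ ∣ + ∣ S₂ ∣)             ≡⟨ regroup (∣ U ∣) d₁ d₂ (∣ S₁ ∣) (∣ S₂ ∣) ⟩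
      ∣ U ∣ + ((d₁ + ∣ S₁ ∣) + (d₂ + ∣ S₂ ∣))         ≤⟨ +-mono-≤ ∣U∣≤t (+-mono-≤ (<⇒≤ small₁) (<⇒≤ small₂)) ⟩
      -- Apart from the sizes of `S₁` and `S₂` this is 3s + 1, against `N` = 4s + 3. Of the slack s
      -- + 2, one unit gives strictness and the remaining `suc s` is added on the right.
      t + ((s + ∣ S₂ ∣) + (s + ∣ S₁ ∣))               <⟨ m≤m+n _ _ ⟩
      suc (t + ((s + ∣ S₂ ∣) + (s + ∣ S₁ ∣))) + suc s ≡⟨ shuffle s (∣ S₁ ∣) (∣ S₂ ∣) ⟩
      N + (∣ S₁ ∣ + ∣ S₂ ∣)                           ∎)
    where
    open ≤-Reasoning
    U : Subset N
    U = S₀ ∪ S₁ ∪ S₂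
    ∣U∣≤t : ∣ U ∣ ≤ t
    ∣U∣≤t = ≤-trans (∣p∪q∪r∣≤∣p∣+∣q∣+∣r∣ S₀ S₁ S₂) (≤-reflexive total)
    S₀⊆U : S₀ ⊆ U
    S₀⊆U x∈ = x∈p∪q⁺ (inj₁ x∈)
    S₁⊆U : S₁ ⊆ U
    S₁⊆U x∈ = x∈p∪q⁺ (inj₂ (x∈p∪q⁺ (inj₁ x∈)))
    S₂⊆U : S₂ ⊆ U
    S₂⊆U x∈ = x∈p∪q⁺ (inj₂ (x∈p∪q⁺ (inj₂ x∈)))
    d₁ d₂ : ℕ
    d₁ = ∣ D U S₁ ∣
    d₂ = ∣ D U S₂ ∣
    small₁ : d₁ + ∣ S₁ ∣ < s + ∣ S₂ ∣
    small₁ = ≰⇒> (noMatching ∘ matchThreeCliques U ∣U∣≤t S₀ S₁ S₂ S₀⊆U S₁⊆U S₂⊆U total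
      S₀∩S₁ S₀∩S₂ S₁∩S₂ clique₀ clique₁ clique₂ complete₁ complete₂ anticomplete)
    small₂ : d₂ + ∣ S₂ ∣ < s + ∣ S₁ ∣
    small₂ = ≰⇒> (noMatching ∘ matchThreeCliques U ∣U∣≤t S₀ S₂ S₁ S₀⊆U S₂⊆U S₁⊆U
      (trans (swapʳ (∣ S₀ ∣) (∣ S₂ ∣) (∣ S₁ ∣)) total)
      S₀∩S₂ S₀∩S₁ (λ (x , x∈) → S₁∩S₂ (x , subst (x ∈_) (∩-comm S₂ S₁) x∈))
      clique₀ clique₂ clique₁ complete₂ complete₁ (λ a∈ b∈ → anticomplete b∈ a∈ ∘ Adj-sym))
      where
      swapʳ : ∀ a b c → a + b + c ≡ a + c + b
      swapʳ = solve-∀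
    regroup : ∀ u d e a b → u + d + e + (a + b) ≡ u + ((d + a) + (e + b))
    regroup = solve-∀
    shuffle : ∀ s a b → suc (suc s + ((s + b) + (s + a))) + suc s ≡ s + 3 * suc s + (a + b)
    shuffle = solve-∀

-- Shrinking the cliques to total size t

splitSum : ∀ {m n} k → k ≤ m + n → ∃[ i ] ∃[ j ] (i ≤ m × j ≤ n × i + j ≡ k)
splitSum {m} k k≤m+n =
  -- As much as possible is taken from the first summand, the remainder from the second.
  m ⊓ k , k ∸ m , m⊓n≤m m k , m≤n+o⇒m∸n≤o k m k≤m+n , m⊓n+n∸m≡n m k

Empty-∩-mono : {p p′ q q′ : Subset n} → p′ ⊆ p → q′ ⊆ q → Empty (p ∩ q) → Empty (p′ ∩ q′)
Empty-∩-mono {p′ = p′} {q′ = q′} p′⊆p q′⊆q p∩q=∅ (x , x∈) with x∈p∩q⁻ p′ q′ x∈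
... | x∈p′ , x∈q′ = p∩q=∅ (x , x∈p∩q⁺ (p′⊆p x∈p′ , q′⊆q x∈q′))

theorem1p5 : (t : ℕ) → .{{_ : NonZero t}} →
    (n : ℕ) → n ≡ 4 * t ∸ 1 → (G : Graph n) →
    IsIndependenceNumber G 2 →
    (cm : ℕ) → IsConnectedMatchingNumber G cm → cm ≤ t ∸ 1 →
    (S₀ S₁ S₂ : Subset n) →
    Empty (S₀ ∩ S₁) → Empty (S₀ ∩ S₂) → Empty (S₁ ∩ S₂) →
    IsClique G S₀ → IsClique G S₁ → IsClique G S₂ →
    CompleteTo G S₀ (S₁ ∪ S₂) → AnticompleteTo G S₁ S₂ →
    ∣ S₀ ∣ + ∣ S₁ ∣ + ∣ S₂ ∣ ≤ t ∸ 1
theorem1p5 (suc s) _ refl G α≡2 cm (_ , cm-max) cm≤s S₀ S₁ S₂ S₀∩S₁ S₀∩S₂ S₁∩S₂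
  clique₀ clique₁ clique₂ complete anticomplete = ≮⇒≥ λ t≤ →
  -- A total of at least t is reduced to exactly t by passing to subsets `T₀`, `T₁`, `T₂`, which
  -- inherit disjointness and every adjacency condition.
  let t₀₁ , t₂ , t₀₁≤ , t₂≤ , t₀₁+t₂≡t = splitSum (suc s) t≤
      t₀ , t₁ , t₀≤ , t₁≤ , t₀+t₁≡t₀₁  = splitSum t₀₁ t₀₁≤
      T₀ , T₀⊆ , ∣T₀∣≡t₀ = subsetOfSize S₀ t₀≤
      T₁ , T₁⊆ , ∣T₁∣≡t₁ = subsetOfSize S₁ t₁≤
      T₂ , T₂⊆ , ∣T₂∣≡t₂ = subsetOfSize S₂ t₂≤
  in ∣S₀∣+∣S₁∣+∣S₂∣≢t s G α≡2
       (λ M → 1+n≰n (≤-trans (cm-max (suc s) M) cm≤s))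
       T₀ T₁ T₂
       (Empty-∩-mono T₀⊆ T₁⊆ S₀∩S₁) (Empty-∩-mono T₀⊆ T₂⊆ S₀∩S₂) (Empty-∩-mono T₁⊆ T₂⊆ S₁∩S₂)
       (λ u∈ v∈ → clique₀ (T₀⊆ u∈) (T₀⊆ v∈))
       (λ u∈ v∈ → clique₁ (T₁⊆ u∈) (T₁⊆ v∈))
       (λ u∈ v∈ → clique₂ (T₂⊆ u∈) (T₂⊆ v∈))
       (λ a∈ b∈ → complete (T₀⊆ a∈) (x∈p∪q⁺ (inj₁ (T₁⊆ b∈))))
       (λ a∈ b∈ → complete (T₀⊆ a∈) (x∈p∪q⁺ (inj₂ (T₂⊆ b∈))))
       (λ a∈ b∈ → anticomplete (T₁⊆ a∈) (T₂⊆ b∈))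
       (trans (cong₂ _+_ (trans (cong₂ _+_ ∣T₀∣≡t₀ ∣T₁∣≡t₁) t₀+t₁≡t₀₁) ∣T₂∣≡t₂) t₀₁+t₂≡t)
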